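{- For every deterministic online algorithm with predictions for interval selection with proportional weights in the model of irrevocable decisions, there exist an instance with proportional weights (with an arrival order and a fixed optimal solution) and predictions, with total error $\eta$, such that $ALG = OPT - \eta$.
   Context: Interval selection: an instance is a finite nonempty set $\mathcal{I}$ of intervals $[s_i,f_i)$ on the real line, $s_i<f_i$, arriving one at a time in an arbitrary (adversarial) order. Two intervals conflict if they intersect. Each interval $I$ has a weight $w(I)$; proportional weights means $w([s,f))=f-s$. The goal is to output a set of pairwise disjoint intervals of maximum total weight. $OPT$ denotes the maximum total weight of a set of pairwise disjoint intervals of the instance, and $ALG$ the total weight of the algorithm's final solution. Irrevocable decisions: upon each arrival, the algorithm, knowing only the intervals and predictions revealed so far, must accept or reject the interval; both decisions are final, and the accepted intervals must be pairwise disjoint. Predictions: each interval $I$ arrives together with a bit $Prd(I)\in\{0,1\}$; $Prd(I)=1$ means $I$ is predicted to belong to a fixed optimal solution $O$, and $Prd(I)=0$ means it is predicted not to belong to $O$. The prediction of $I$ is accurate if ($Prd(I)=1 \iff I\in O$). Error (with respect to $O$): $\eta(I)=0$ if the prediction of $I$ is accurate; $\eta(I)=w(I)$ if $I\in O$ and $Prd(I)=0$; $\eta(I)=\sum_{J\in\mathcal{C}}w(J)-w(I)$ if $I\notin O$ and $Prd(I)=1$, where $\mathcal{C}$ is the set of intervals of $O$ that conflict with $I$. The total error is $\eta=\sum_{I\in\mathcal{I}}\eta(I)$. -}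

module Defs where

open import Data.Bool using (Bool; true; false; if_then_else_; _∧_)
open import Data.Fin using (Fin)
open import Data.Fin.Subset using (Subset; _∈_)
open import Data.List using (List; []; _∷ʳ_)
open import Data.Nat as ℕ using (ℕ; NonZero)
import Data.Nat.Properties as ℕ
open import Data.Product using (_×_; _,_; ∃-syntax)
open import Data.Rational as ℚ using (ℚ; 0ℚ; ½)
import Data.Rational.Properties as ℚ
open import Data.Rational.Solver using (module +-*-Solver)
open import Data.Vec using (Vec; []; _∷_; lookup; tabulate; zip)
import Data.Vec.Functional as Functional
open import Relation.Binary.PropositionalEquality
  using (_≡_; _≢_; refl; sym; trans; cong; subst)
open import Relation.Nullary using (¬_; Dec; does)

-- The real line: Cauchy sequences of rationals, with equality and order
-- as relations on sequences (no quotient is formed).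

record ℝ : Set where
  field
    approx : ℕ → ℚ
    cauchy : ∀ ε → 0ℚ ℚ.< ε → ∃[ N ] ∀ m n → N ℕ.≤ m → N ℕ.≤ n →
             ℚ.∣ approx m ℚ.- approx n ∣ ℚ.< ε
open ℝ public

infix 4 _≃_ _<_ _≤_

_≃_ : ℝ → ℝ → Set
x ≃ y = ∀ ε → 0ℚ ℚ.< ε → ∃[ N ] ∀ n → N ℕ.≤ n →
        ℚ.∣ approx x n ℚ.- approx y n ∣ ℚ.< ε

_<_ : ℝ → ℝ → Set
x < y = ∃[ ε ] 0ℚ ℚ.< ε ×
        (∃[ N ] ∀ n → N ℕ.≤ n → approx x n ℚ.+ ε ℚ.≤ approx y n)

_≤_ : ℝ → ℝ → Set
x ≤ y = ∀ ε → 0ℚ ℚ.< ε → ∃[ N ] ∀ n → N ℕ.≤ n →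
        approx x n ℚ.≤ approx y n ℚ.+ ε

private
  halve : ∀ ε → ½ ℚ.* ε ℚ.+ ½ ℚ.* ε ≡ ε
  halve ε = trans (sym (ℚ.*-distribʳ-+ ε ½ ½)) (ℚ.*-identityˡ ε)

  0<½* : ∀ {ε} → 0ℚ ℚ.< ε → 0ℚ ℚ.< ½ ℚ.* ε
  0<½* 0<ε = ℚ.*-monoʳ-<-pos ½ 0<ε

  rearrange : ∀ a b c d →
              (a ℚ.+ b) ℚ.- (c ℚ.+ d) ≡ (a ℚ.- c) ℚ.+ (b ℚ.- d)
  rearrange = solve 4 (λ a b c d →
    (a :+ b) :- (c :+ d) := (a :- c) :+ (b :- d)) refl
    where open +-*-Solver

infixl 6 _+_ _-_
infix  8 -_

0ℝ : ℝ
0ℝ .approx _ = 0ℚ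
0ℝ .cauchy ε 0<ε = 0 , λ _ _ _ _ → 0<ε

_+_ : ℝ → ℝ → ℝ
(x + y) .approx n = approx x n ℚ.+ approx y n
(x + y) .cauchy ε 0<ε with cauchy x (½ ℚ.* ε) (0<½* 0<ε)
                         | cauchy y (½ ℚ.* ε) (0<½* 0<ε)
... | M , p | N , q = M ℕ.⊔ N , λ m n m≥ n≥ → begin-strict
  ℚ.∣ (approx x m ℚ.+ approx y m) ℚ.- (approx x n ℚ.+ approx y n) ∣
    ≡⟨ cong ℚ.∣_∣ (rearrange (approx x m) (approx y m) (approx x n) (approx y n)) ⟩
  ℚ.∣ (approx x m ℚ.- approx x n) ℚ.+ (approx y m ℚ.- approx y n) ∣
    ≤⟨ ℚ.∣p+q∣≤∣p∣+∣q∣ (approx x m ℚ.- approx x n) (approx y m ℚ.- approx y n) ⟩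
  ℚ.∣ approx x m ℚ.- approx x n ∣ ℚ.+ ℚ.∣ approx y m ℚ.- approx y n ∣
    <⟨ ℚ.+-mono-< (p m n (ℕ.m⊔n≤o⇒m≤o M N m≥) (ℕ.m⊔n≤o⇒m≤o M N n≥))
                  (q m n (ℕ.m⊔n≤o⇒n≤o M N m≥) (ℕ.m⊔n≤o⇒n≤o M N n≥)) ⟩
  ½ ℚ.* ε ℚ.+ ½ ℚ.* ε
    ≡⟨ halve ε ⟩
  ε ∎
  where open ℚ.≤-Reasoning

-_ : ℝ → ℝ
(- x) .approx n = ℚ.- approx x n
(- x) .cauchy ε 0<ε with cauchy x ε 0<ε
... | N , p = N , λ m n m≥ n≥ →
  subst (ℚ._< ε)
    (trans (sym (ℚ.∣-p∣≡∣p∣ (approx x m ℚ.- approx x n)))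
           (cong ℚ.∣_∣ (ℚ.neg-distrib-+ (approx x m) (ℚ.- approx x n))))
    (p m n m≥ n≥)

_-_ : ℝ → ℝ → ℝ
x - y = x + (- y)

-- The half-open interval [ start , finish ).

record Interval : Set where
  constructor interval
  field
    start finish : ℝ
    start<finish : start < finish
open Interval public

_≈_ : Interval → Interval → Set
I ≈ J = start I ≃ start J × finish I ≃ finish J

_∈ᴵ_ : ℝ → Interval → Set
x ∈ᴵ I = start I ≤ x × x < finish I

Conflict : Interval → Interval → Set
Conflict I J = ∃[ x ] (x ∈ᴵ I × x ∈ᴵ J)

-- Proportional weights.

weight : Interval → ℝ
weight I = finish I - start I

-- A finite set of intervals is listed, without repetition, in its order of
-- arrival; its subsets are sets of positions in that list.

Distinct : ∀ {n} → Vec Interval n → Set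
Distinct Is = ∀ i j → i ≢ j → ¬ (lookup Is i ≈ lookup Is j)

PairwiseDisjoint : ∀ {n} → Vec Interval n → Subset n → Set
PairwiseDisjoint Is S =
  ∀ i j → i ∈ S → j ∈ S → i ≢ j → ¬ Conflict (lookup Is i) (lookup Is j)

sum : ∀ {n} → (Fin n → ℝ) → ℝ
sum = Functional.foldr _+_ 0ℝ

totalWeight : ∀ {n} → Vec Interval n → Subset n → ℝ
totalWeight Is S = sum λ i → if lookup S i then weight (lookup Is i) else 0ℝ

IsOptimal : ∀ {n} → Vec Interval n → Subset n → Set
IsOptimal Is O =
  PairwiseDisjoint Is O ×
  (∀ S → PairwiseDisjoint Is S → totalWeight Is S ≤ totalWeight Is O)

-- An arriving interval together with its prediction bit.

Request : Set
Request = Interval × Bool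

-- A rule decides on the current request from the earlier ones (oldest
-- first); true means accept. Being deterministic, it can recompute its own
-- earlier decisions, so these need not be passed to it.

Rule : Set
Rule = List Request → Request → Bool

runFrom : ∀ {n} → Rule → List Request → Vec Request n → Subset n
runFrom d past []       = []
runFrom d past (r ∷ rs) = d past r ∷ runFrom d (past ∷ʳ r) rs

accepted : ∀ {n} → Rule → Vec Interval n → Vec Bool n → Subset n
accepted d Is prd = runFrom d [] (zip Is prd)

-- The rule need not respect _≃_ on endpoints: it may depend on the chosen
-- representatives. Rules that depend only on the reals are a special case.

record OnlineAlgorithm : Set where
  field
    decide   : Rule
    feasible : ∀ {n} (Is : Vec Interval n) (prd : Vec Bool n) →
               Distinct Is → PairwiseDisjoint Is (accepted decide Is prd)
open OnlineAlgorithm public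

-- Conflict is not decidable for arbitrary reals, so an instance carries the
-- truth value of each of its finitely many conflicts; classically this is no
-- restriction, and the truth values, hence the errors, are determined.

record PredictedInstance : Set where
  field
    size      : ℕ
    nonEmpty  : NonZero size
    intervals : Vec Interval size
    distinct  : Distinct intervals
    optimum   : Subset size
    isOptimal : IsOptimal intervals optimum
    Prd       : Vec Bool size
    conflict? : ∀ i j → Dec (Conflict (lookup intervals i) (lookup intervals j))

  w : Fin size → ℝ
  w i = weight (lookup intervals i)

  OPT : ℝ
  OPT = totalWeight intervals optimum

  conflictsInOptimum : Fin size → Subset size
  conflictsInOptimum i = tabulate λ j → lookup optimum j ∧ does (conflict? i j)

  error : Fin size → ℝ
  error i with lookup optimum i | lookup Prd i
  ... | true  | true  = 0ℝ
  ... | false | false = 0ℝ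
  ... | true  | false = w i
  ... | false | true  = totalWeight intervals (conflictsInOptimum i) - w i

  η : ℝ
  η = sum error

  ALG : OnlineAlgorithm → ℝ
  ALG A = totalWeight intervals (accepted (decide A) intervals Prd)

-- The adversary opens with an interval I of weight 1 predicted 0. If it is
-- rejected, the instance stops: OPT = η = 1 and ALG = 0. If it is accepted,
-- two adjacent intervals of weights ½ and 1 follow, both conflicting with I and
-- with predictions 0 and 1. They form the optimum, so OPT = 3/2, while ALG = 1
-- and only the first of them is mispredicted: η = ½.
module Submission where

open import Defs
open import Data.Bool using (true; false)
open import Data.Fin.Patterns using (0F; 1F; 2F)
open import Data.Fin.Subset using (Subset)
open import Data.List using ([])
import Data.Nat as ℕ
import Data.Nat.Properties as ℕ
open import Data.Product using (_×_; _,_; proj₁; proj₂; ∃-syntax)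
open import Data.Rational as ℚ using (ℚ; 0ℚ; ½; -½; 1ℚ)
import Data.Rational.Properties as ℚ
open import Algebra.Properties.Group ℚ.+-0-group using (x∙y⁻¹≈ε⇒x≈y)
open import Data.Sum using (inj₁; inj₂)
open import Data.Vec using (Vec; []; _∷_; lookup; here; there)
open import Function using (_∘_)
open import Relation.Binary.Definitions using (tri<; tri≈; tri>)
open import Relation.Binary.PropositionalEquality
  using (_≡_; refl; sym; trans; cong; subst)
open import Relation.Nullary using (Dec; contradiction; _×-dec_)
open import Relation.Nullary.Decidable using (from-yes; map′)

fromℚ : ℚ → ℝ
fromℚ q .approx _ = q
fromℚ q .cauchy ε 0<ε = 0 , λ _ _ _ _ →
  subst (ℚ._< ε) (sym (cong ℚ.∣_∣ (ℚ.+-inverseʳ q))) 0<ε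

-- All reals of the two instances are built from constant sequences, so this and `pointwise-≤`
-- reduce comparisons of weights to closed rational facts.
pointwise-≃ : ∀ x y → (∀ n → approx x n ≡ approx y n) → x ≃ y
pointwise-≃ x y x≡y ε 0<ε = 0 , λ n _ →
  subst (ℚ._< ε)
    (sym (cong ℚ.∣_∣ (trans (cong (ℚ._- approx y n) (x≡y n))
                            (ℚ.+-inverseʳ (approx y n)))))
    0<ε

pointwise-≤ : ∀ x y → (∀ n → approx x n ℚ.≤ approx y n) → x ≤ y
pointwise-≤ x y x≤y ε 0<ε = 0 , λ n _ →
  ℚ.≤-trans (x≤y n)
    (subst (ℚ._≤ approx y n ℚ.+ ε) (ℚ.+-identityʳ (approx y n))
      (ℚ.+-monoʳ-≤ (approx y n) (ℚ.<⇒≤ 0<ε)))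

fromℚ-mono-≤ : ∀ {p q} → p ℚ.≤ q → fromℚ p ≤ fromℚ q
fromℚ-mono-≤ {p} {q} p≤q = pointwise-≤ (fromℚ p) (fromℚ q) λ _ → p≤q

fromℚ-mono-< : ∀ {p q} → p ℚ.< q → fromℚ p < fromℚ q
fromℚ-mono-< {p} {q} p<q = q ℚ.- p , 0<q-p , 0 , λ _ _ → ℚ.≤-reflexive p+[q-p]≡q
  where
  0<q-p : 0ℚ ℚ.< q ℚ.- p
  0<q-p = subst (ℚ._< q ℚ.- p) (ℚ.+-inverseʳ p) (ℚ.+-monoˡ-< (ℚ.- p) p<q)

  p+[q-p]≡q : p ℚ.+ (q ℚ.- p) ≡ q
  p+[q-p]≡q = trans (ℚ.+-comm p (q ℚ.- p))
             (trans (ℚ.+-assoc q (ℚ.- p) p)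
             (trans (cong (q ℚ.+_) (ℚ.+-inverseˡ p)) (ℚ.+-identityʳ q)))

≤-<-between : ∀ x {p q} → fromℚ p ≤ x → x < fromℚ q → p ℚ.< q
≤-<-between x {p} {q} p≤x (ε , 0<ε , M , x+ε≤q)
  -- The slack granted by `≤` has to stay strictly below the gap `ε` provided by `<`; half of it
  -- suffices.
  with p≤x (½ ℚ.* ε) (ℚ.*-monoʳ-<-pos ½ 0<ε)
... | N , p≤x+½ε = begin-strict
  p                            ≤⟨ p≤x+½ε k (ℕ.m≤n⊔m M N) ⟩
  approx x k ℚ.+ ½ ℚ.* ε       <⟨ ℚ.+-monoʳ-< (approx x k) ½ε<ε ⟩
  approx x k ℚ.+ ε             ≤⟨ x+ε≤q k (ℕ.m≤m⊔n M N) ⟩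
  q                            ∎
  where
  open ℚ.≤-Reasoning
  k = M ℕ.⊔ N

  ½ε<ε : ½ ℚ.* ε ℚ.< ε
  ½ε<ε = subst (½ ℚ.* ε ℚ.<_) (ℚ.*-identityˡ ε)
    (ℚ.*-monoˡ-<-pos ε {{ℚ.positive 0<ε}} (from-yes (½ ℚ.<? 1ℚ)))

-- If the distance of `p` and `q` were positive, it could itself serve as the tolerance, and would
-- then be smaller than itself.
fromℚ-injective : ∀ p q → fromℚ p ≃ fromℚ q → p ≡ q
fromℚ-injective p q p≃q with ℚ.<-cmp 0ℚ ℚ.∣ p ℚ.- q ∣
... | tri≈ _ 0≡∣p-q∣ _ = x∙y⁻¹≈ε⇒x≈y p q (ℚ.∣p∣≡0⇒p≡0 (p ℚ.- q) (sym 0≡∣p-q∣))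
... | tri> _ _ ∣p-q∣<0 =
  contradiction (ℚ.<-≤-trans ∣p-q∣<0 (ℚ.0≤∣p∣ (p ℚ.- q))) (ℚ.<-irrefl refl)
... | tri< 0<∣p-q∣ _ _ with N , close ← p≃q ℚ.∣ p ℚ.- q ∣ 0<∣p-q∣ =
  contradiction (close N ℕ.≤-refl) (ℚ.<-irrefl refl)

-- Rational endpoints make overlap decidable, which supplies the truth values of the conflicts that
-- an instance must carry.
record ℚInterval : Set where
  constructor [_,_⟩∋_
  field
    left right : ℚ
    left<right : left ℚ.< right
open ℚInterval

⟦_⟧ : ℚInterval → Interval
⟦ [ p , q ⟩∋ p<q ⟧ = interval (fromℚ p) (fromℚ q) (fromℚ-mono-< p<q)

-- The larger of the two left endpoints is a common point.
overlap⇒conflict : ∀ I J → left I ℚ.< right J × left J ℚ.< right I →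
                   Conflict ⟦ I ⟧ ⟦ J ⟧
overlap⇒conflict I J (l<r′ , l′<r) with ℚ.≤-total (left I) (left J)
... | inj₁ l≤l′ = fromℚ (left J) ,
  (fromℚ-mono-≤ l≤l′ , fromℚ-mono-< l′<r) ,
  (fromℚ-mono-≤ ℚ.≤-refl , fromℚ-mono-< (left<right J))
... | inj₂ l′≤l = fromℚ (left I) ,
  (fromℚ-mono-≤ ℚ.≤-refl , fromℚ-mono-< (left<right I)) ,
  (fromℚ-mono-≤ l′≤l , fromℚ-mono-< l<r′)

conflict⇒overlap : ∀ I J → Conflict ⟦ I ⟧ ⟦ J ⟧ →
                   left I ℚ.< right J × left J ℚ.< right I
conflict⇒overlap I J (x , (l≤x , x<r) , (l′≤x , x<r′)) =
  ≤-<-between x l≤x x<r′ , ≤-<-between x l′≤x x<r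

Conflict? : ∀ I J → Dec (Conflict ⟦ I ⟧ ⟦ J ⟧)
Conflict? I J = map′ (overlap⇒conflict I J) (conflict⇒overlap I J)
  (left I ℚ.<? right J ×-dec left J ℚ.<? right I)

-- `leftHalf` and `rightPart` touch at 0 without conflict, the intervals being half-open; `middle`
-- has 0 in its interior and so overlaps both.
middle leftHalf rightPart : ℚInterval
middle    = [ -½ , ½  ⟩∋ from-yes (-½ ℚ.<? ½)
leftHalf  = [ -½ , 0ℚ ⟩∋ from-yes (-½ ℚ.<? 0ℚ)
rightPart = [ 0ℚ , 1ℚ ⟩∋ from-yes (0ℚ ℚ.<? 1ℚ)

single : Vec Interval 1
single = ⟦ middle ⟧ ∷ []

triple : Vec Interval 3
triple = ⟦ middle ⟧ ∷ ⟦ leftHalf ⟧ ∷ ⟦ rightPart ⟧ ∷ []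

rejectedInstance : PredictedInstance
rejectedInstance = record
  { size      = 1
  ; nonEmpty  = _
  ; intervals = single
  ; distinct  = λ { 0F 0F 0≢0 → contradiction refl 0≢0 }
  ; optimum   = true ∷ []
  ; isOptimal = (λ { 0F 0F _ _ 0≢0 → contradiction refl 0≢0 }) , λ S _ → optimal S
  ; Prd       = false ∷ []
  ; conflict? = λ { 0F 0F → Conflict? middle middle }
  }
  where
  optimal : ∀ S → totalWeight single S ≤ totalWeight single (true ∷ [])
  optimal S = pointwise-≤ (totalWeight single S) (totalWeight single (true ∷ []))
    (bound S)
    where
    bound : ∀ S n → approx (totalWeight single S) n ℚ.≤ 1ℚ
    bound (true  ∷ []) _ = from-yes (1ℚ ℚ.≤? 1ℚ)
    bound (false ∷ []) _ = from-yes (0ℚ ℚ.≤? 1ℚ)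

-- Used twice: to bound the weight of competing solutions, and to force the algorithm's later
-- decisions once it has accepted `middle`.
middle-excludes : ∀ {b c} → PairwiseDisjoint triple (true ∷ b ∷ c ∷ []) →
                  b ∷ c ∷ [] ≡ false ∷ false ∷ []
middle-excludes {false} {false} _ = refl
middle-excludes {true} disjoint = contradiction
  (overlap⇒conflict middle leftHalf
    (from-yes (-½ ℚ.<? 0ℚ) , from-yes (-½ ℚ.<? ½)))
  (disjoint 0F 1F here (there here) λ ())
middle-excludes {false} {true} disjoint = contradiction
  (overlap⇒conflict middle rightPart
    (from-yes (-½ ℚ.<? 1ℚ) , from-yes (0ℚ ℚ.<? ½)))
  (disjoint 0F 2F here (there (there here)) λ ())

acceptedInstance : PredictedInstance
acceptedInstance = record
  { size      = 3
  ; nonEmpty  = _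
  ; intervals = triple
  ; distinct  = distinct
  ; optimum   = O
  ; isOptimal = disjoint , λ S S-disjoint →
      pointwise-≤ (totalWeight triple S) (totalWeight triple O) (bound S S-disjoint)
  ; Prd       = false ∷ false ∷ true ∷ []
  ; conflict? = conflict?
  }
  where
  O : Subset 3
  O = false ∷ true ∷ true ∷ []

  distinct : Distinct triple
  distinct 0F 0F i≢i _ = i≢i refl
  distinct 1F 1F i≢i _ = i≢i refl
  distinct 2F 2F i≢i _ = i≢i refl
  -- The right endpoints ½, 0 and 1 already tell the intervals apart; two of the left endpoints
  -- coincide.
  distinct 0F 1F _ (_ , f≃f′) with () ← fromℚ-injective ½ 0ℚ f≃f′
  distinct 0F 2F _ (_ , f≃f′) with () ← fromℚ-injective ½ 1ℚ f≃f′
  distinct 1F 0F _ (_ , f≃f′) with () ← fromℚ-injective 0ℚ ½ f≃f′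
  distinct 1F 2F _ (_ , f≃f′) with () ← fromℚ-injective 0ℚ 1ℚ f≃f′
  distinct 2F 0F _ (_ , f≃f′) with () ← fromℚ-injective 1ℚ ½ f≃f′
  distinct 2F 1F _ (_ , f≃f′) with () ← fromℚ-injective 1ℚ 0ℚ f≃f′

  disjoint : PairwiseDisjoint triple O
  disjoint 1F 1F _ _ i≢i _ = i≢i refl
  disjoint 2F 2F _ _ i≢i _ = i≢i refl
  disjoint 1F 2F _ _ _ c =
    ℚ.<-irrefl refl (proj₂ (conflict⇒overlap leftHalf rightPart c))
  disjoint 2F 1F _ _ _ c =
    ℚ.<-irrefl refl (proj₁ (conflict⇒overlap rightPart leftHalf c))

  bound : ∀ S → PairwiseDisjoint triple S → ∀ n →
          approx (totalWeight triple S) n ℚ.≤ 1ℚ ℚ.+ ½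
  -- With `middle` chosen nothing else fits, so the weight is 1; the remaining cases are the subsets
  -- of the other two intervals.
  bound (true ∷ b ∷ c ∷ []) S-disjoint n with refl ← middle-excludes S-disjoint =
    from-yes (1ℚ ℚ.≤? 1ℚ ℚ.+ ½)
  bound (false ∷ false ∷ false ∷ []) _ _ = from-yes (0ℚ ℚ.≤? 1ℚ ℚ.+ ½)
  bound (false ∷ false ∷ true  ∷ []) _ _ = from-yes (1ℚ ℚ.≤? 1ℚ ℚ.+ ½)
  bound (false ∷ true  ∷ false ∷ []) _ _ = from-yes (½  ℚ.≤? 1ℚ ℚ.+ ½)
  bound (false ∷ true  ∷ true  ∷ []) _ _ = ℚ.≤-refl

  conflict? : ∀ i j → Dec (Conflict (lookup triple i) (lookup triple j))
  conflict? 0F 0F = Conflict? middle middle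
  conflict? 0F 1F = Conflict? middle leftHalf
  conflict? 0F 2F = Conflict? middle rightPart
  conflict? 1F 0F = Conflict? leftHalf middle
  conflict? 1F 1F = Conflict? leftHalf leftHalf
  conflict? 1F 2F = Conflict? leftHalf rightPart
  conflict? 2F 0F = Conflict? rightPart middle
  conflict? 2F 1F = Conflict? rightPart leftHalf
  conflict? 2F 2F = Conflict? rightPart rightPart

-- The accepted set of an abstract algorithm does not compute. Replacing it by a concrete `S` turns
-- the claim into an equation of closed rationals, which holds by `refl` in both instances.
attains : (A : OnlineAlgorithm) (P : PredictedInstance) →
          let open PredictedInstance P in
          ∀ S → accepted (decide A) intervals Prd ≡ S →
          (∀ n → approx (totalWeight intervals S) n ≡ approx (OPT - η) n) →
          ALG A ≃ OPT - η
attains A P S refl = pointwise-≃ (ALG A) (OPT - η)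
  where open PredictedInstance P

-- Both instances begin with this request and an empty history, so the decision on it cannot depend
-- on which of them follows.
opening : Request
opening = ⟦ middle ⟧ , false

rejected-attains : ∀ A → decide A [] opening ≡ false →
  let open PredictedInstance rejectedInstance in ALG A ≃ OPT - η
rejected-attains A rejects =
  attains A rejectedInstance (false ∷ []) (cong (_∷ []) rejects) λ _ → refl

accepted-attains : ∀ A → decide A [] opening ≡ true →
  let open PredictedInstance acceptedInstance in ALG A ≃ OPT - η
accepted-attains A accepts =
  attains A acceptedInstance (true ∷ false ∷ false ∷ []) run λ _ → refl
  where
  open PredictedInstance acceptedInstance

  -- The decisions are generalised to variables so that the known first one can be matched with
  -- `refl`; the other two then follow from feasibility alone.
  force : ∀ {a b c} → a ≡ true → PairwiseDisjoint triple (a ∷ b ∷ c ∷ []) →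
          a ∷ b ∷ c ∷ [] ≡ true ∷ false ∷ false ∷ []
  force refl = cong (true ∷_) ∘ middle-excludes

  run : accepted (decide A) intervals Prd ≡ true ∷ false ∷ false ∷ []
  run = force accepts (feasible A intervals Prd distinct)

theorem3p6 : (A : OnlineAlgorithm) → ∃[ P ] (let open PredictedInstance P in ALG A ≃ OPT - η)
theorem3p6 A = respond (decide A [] opening) refl
  where
  respond : ∀ b → decide A [] opening ≡ b →
            ∃[ P ] (let open PredictedInstance P in ALG A ≃ OPT - η)
  respond false rejects = rejectedInstance , rejected-attains A rejects
  respond true  accepts = acceptedInstance , accepted-attains A accepts
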